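{- Let $n_0 = 3\cdot 5\cdot 7\cdot 11\cdot 13\cdot 17\cdot 19\cdot 23 = 111546435$. The number of conflicts in the partition $$\{\,S_{1,n_0}\cup\{n_0\},\ S_{2,n_0}\setminus\{n_0\}\,\}\cup\{S_{j,n_0} : j\ge 3,\ S_{j,n_0}\neq\emptyset\}$$ of $\{2,3,\dots,n_0\}$ is strictly less than the number of conflicts in the partition $$\{S_{j,n_0} : j\ge 1,\ S_{j,n_0}\neq\emptyset\}$$ of $\{2,3,\dots,n_0\}$. In particular, the latter partition does not have the minimal number of conflicts among all partitions of $\{2,\dots,n_0\}$.
   Context: Let $p_i$ denote the $i$-th prime ($p_1=2$, $p_2=3,\dots$). For $i\ge1$ and a positive integer $n$, $S_{i,n}$ is the set of positive integers $m\le n$ with $p_i\mid m$ and $p_j\nmid m$ for all $j<i$. Two distinct integers $a,b\ge 2$ are friends if $\gcd(a,b)>1$ and enemies if $\gcd(a,b)=1$. Given a partition of a finite set of integers $\ge2$, a pair $\{a,b\}$ of distinct elements is in conflict if $a,b$ are enemies lying in the same class, or friends lying in different classes. The number of conflicts of a partition is the number of such unordered pairs. -}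

module Defs where

open import Level using (0ℓ)
open import Data.List.Base using (List; []; _∷_; length)
open import Data.List.Membership.Propositional using () renaming (_∈_ to _∈ₗ_)
open import Data.List.Relation.Unary.All using ([]; _∷_)
open import Data.List.Relation.Unary.Unique.Propositional using (Unique)
open import Data.Nat.Base
open import Data.Nat.Divisibility
open import Data.Nat.GCD using (gcd)
open import Data.Nat.ListAction using (product)
open import Data.Nat.Primality
open import Data.Nat.Primality.Factorisation
open import Data.Nat.Properties
open import Data.Product.Base using (_×_; _,_; ∃; proj₁; proj₂)
open import Data.Sum.Base using (_⊎_)
open import Function.Bundles using (_⇔_)
open import Relation.Binary.PropositionalEquality
open import Relation.Nullary using (¬_; yes; no; contradiction)
open import Relation.Unary using (Pred; _∈_; _⊆_; _≐_; _≬_; _∪_; _∖_; ｛_｝; Satisfiable)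

IsLeastPrimeFrom : ℕ → Pred ℕ 0ℓ
IsLeastPrimeFrom m p = Prime p × m ≤ p × (∀ {q} → Prime q → m ≤ q → p ≤ q)

leastPrimeFrom : ∀ k m → Prime (k + m) → ∃ (IsLeastPrimeFrom m)
leastPrimeFrom zero    m pr = m , pr , ≤-refl , λ _ m≤q → m≤q
leastPrimeFrom (suc k) m pr with prime? m
... | yes m-prime = m , m-prime , ≤-refl , λ _ m≤q → m≤q
... | no ¬m-prime with leastPrimeFrom k (suc m) (subst Prime (sym (+-suc k m)) pr)
...   | p , p-prime , m<p , least = p , p-prime , <⇒≤ m<p , λ q-prime m≤q →
          least q-prime (≤∧≢⇒< m≤q λ m≡q → ¬m-prime (subst Prime (sym m≡q) q-prime))

-- Euclid's argument: any prime factor of 1 + n! exceeds n.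
primeAbove : ∀ n → ∃ λ p → Prime p × n < p
primeAbove n with factorise (suc (n !))
... | record { factors = []     ; isFactorisation = 1+n!≡1 } =
  contradiction (suc-injective 1+n!≡1) (m<n⇒n≢0 (1≤n! n))
... | record { factors = p ∷ ps ; isFactorisation = 1+n!≡p*m ; factorsPrime = p-prime ∷ _ } =
  p , p-prime , ≰⇒> λ p≤n → ¬prime[1] (subst Prime (∣1⇒≡1 (p∣1 p≤n)) p-prime)
  where
  p∣p! : ∀ q → Prime q → q ∣ q !
  p∣p! zero    q-prime = contradiction q-prime ¬prime[0]
  p∣p! (suc q) _       = m∣m*n (q !)

  p∣1 : p ≤ n → p ∣ 1
  p∣1 p≤n = ∣m+n∣m⇒∣n
    (subst (p ∣_) (trans (sym 1+n!≡p*m) (+-comm 1 (n !))) (m∣m*n (product ps)))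
    (∣-trans (p∣p! p p-prime) (m≤n⇒m!∣n! p≤n))

nextPrime : ∀ n → ∃ (IsLeastPrimeFrom (suc n))
nextPrime n with primeAbove n
... | p , p-prime , n<p =
  leastPrimeFrom (p ∸ suc n) (suc n) (subst Prime (sym (m∸n+n≡m n<p)) p-prime)

-- The i-th prime, indexed from 1 as in p 1 ≡ 2, p 2 ≡ 3; the value p 0 is
-- only a seed for the recursion.
p : ℕ → ℕ
p zero    = 0
p (suc i) = proj₁ (nextPrime (p i))

S : ℕ → ℕ → Pred ℕ 0ℓ
S i n m = 1 ≤ m × m ≤ n × p i ∣ m × (∀ j → 1 ≤ j → j < i → p j ∤ m)

[2⋯_] : ℕ → Pred ℕ 0ℓ
[2⋯ n ] m = 2 ≤ m × m ≤ n

-- A set of sets of naturals; classes are compared up to extensional equality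
-- _≐_ and never up to _≡_.
Family : Set₁
Family = Pred (Pred ℕ 0ℓ) 0ℓ

record IsPartition (X : Pred ℕ 0ℓ) (𝒫 : Family) : Set₁ where
  field
    nonempty : ∀ {A} → A ∈ 𝒫 → Satisfiable A
    within   : ∀ {A} → A ∈ 𝒫 → A ⊆ X
    disjoint : ∀ {A B} → A ∈ 𝒫 → B ∈ 𝒫 → A ≬ B → A ≐ B
    cover    : ∀ {x} → x ∈ X → ∃ λ A → A ∈ 𝒫 × x ∈ A

Friends Enemies : ℕ → ℕ → Set
Friends a b = a ≢ b × gcd a b > 1
Enemies a b = a ≢ b × gcd a b ≡ 1

InSameClass InDifferentClasses : Family → ℕ → ℕ → Set₁
InSameClass        𝒫 a b = ∃ λ A → A ∈ 𝒫 × a ∈ A × b ∈ A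
InDifferentClasses 𝒫 a b =
  ∃ λ A → ∃ λ B → A ∈ 𝒫 × B ∈ 𝒫 × a ∈ A × b ∈ B × ¬ (A ≐ B)

InConflict : Family → ℕ → ℕ → Set₁
InConflict 𝒫 a b =
  (Enemies a b × InSameClass 𝒫 a b) ⊎ (Friends a b × InDifferentClasses 𝒫 a b)

-- 𝒫 has exactly k conflicts on X.  An unordered pair {a,b} of distinct elements
-- is represented by the ordered pair with a < b.  The count is a relation rather
-- than a function because membership in the classes of an arbitrary family is
-- not decidable; k is nevertheless determined, as any two repetition-free lists
-- with the same elements have the same length.
ConflictCount : Pred ℕ 0ℓ → Family → ℕ → Set₁
ConflictCount X 𝒫 k = ∃ λ (pairs : List (ℕ × ℕ)) →
  Unique pairs × length pairs ≡ k ×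
  (∀ a b → (a , b) ∈ₗ pairs ⇔ (a ∈ X × b ∈ X × a < b × InConflict 𝒫 a b))

HasMinimalConflicts : Pred ℕ 0ℓ → Family → Set₁
HasMinimalConflicts X 𝒫 = ∀ (𝒬 : Family) → IsPartition X 𝒬 →
  ∀ {k l} → ConflictCount X 𝒫 k → ConflictCount X 𝒬 l → k ≤ l

n₀ : ℕ
n₀ = 3 * 5 * 7 * 11 * 13 * 17 * 19 * 23

_ : n₀ ≡ 111546435
_ = refl

standardPartition : ℕ → Family
standardPartition n A = ∃ λ j → 1 ≤ j × Satisfiable (S j n) × A ≐ S j n

modifiedPartition : ℕ → Family
modifiedPartition n A =
  ( A ≐ (S 1 n ∪ ｛ n ｝)
  ⊎ A ≐ (S 2 n ∖ ｛ n ｝)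
  ⊎ (∃ λ j → 3 ≤ j × Satisfiable (S j n) × A ≐ S j n))

{-# OPTIONS --safe #-}

-- The two partitions agree on pairs not containing n = n₀, and n is the largest
-- element, so only the conflicts {a , n} with a < n matter.  Moving n from S₂
-- to S₁ removes the conflicts with the even a that are not coprime to n; it
-- creates conflicts with the even a coprime to n (e of them) and with the other
-- odd multiples of 3 (t of them).  As there are ⌊n/2⌋ even a, the move pays off
-- when 2e + t < ⌊n/2⌋.  Sieving with Legendre's recursion gives
-- e = 18247680 and bounds t by 18591073, while ⌊n/2⌋ = 55773217.

module Submission where

open import Defs
open import Data.List.Base
  using (List; []; _∷_; _++_; length; map; filter; applyUpTo; cartesianProduct)
open import Data.List.Membership.Propositional using () renaming (_∈_ to _∈ₗ_)
open import Data.List.Membership.Propositional.Properties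
  using ( ∈-map⁺; ∈-map⁻; ∈-filter⁺; ∈-filter⁻; ∈-applyUpTo⁺; ∈-applyUpTo⁻
        ; ∈-cartesianProduct⁺; ∈-++⁺ˡ; ∈-++⁺ʳ; ∈-++⁻)
open import Data.List.Membership.Propositional.Properties.WithK using (unique∧set⇒bag)
open import Data.List.Properties
  using (filter-≐; filter-all; length-applyUpTo; length-map; length-++)
open import Data.List.Relation.Binary.BagAndSetEquality using (∼bag⇒↭)
open import Data.List.Relation.Binary.Disjoint.Propositional using (Disjoint)
open import Data.List.Relation.Binary.Permutation.Propositional.Properties
  using (↭-length)
open import Data.List.Relation.Unary.All as All using (All; []; _∷_; all?)
open import Data.List.Relation.Unary.AllPairs using (AllPairs; []; _∷_; allPairs?)
open import Data.List.Relation.Unary.Any using (here; there)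
open import Data.List.Relation.Unary.Unique.Propositional using (Unique)
import Data.List.Relation.Unary.Unique.Propositional.Properties as Unique
open import Data.Nat.Base
open import Data.Nat.Coprimality using (Coprime; coprime?; coprime-divisor)
  renaming (sym to coprime-sym)
open import Data.Nat.DivMod using (_/_; m*n/n≡m; m/n*n≤m; /-monoˡ-≤)
open import Data.Nat.Divisibility
open import Data.Nat.GCD using (gcd; gcd-greatest; gcd[m,n]≢0)
open import Data.Nat.Primality
open import Data.Nat.Primality.Factorisation
open import Data.Nat.Properties
open import Data.Nat.Solver using (module +-*-Solver)
open import Data.Product.Base using (_×_; _,_; ∃; ∃₂; proj₁; proj₂)
open import Data.Sum.Base using (_⊎_; inj₁; inj₂; [_,_]′)
open import Function.Base using (_∘_; case_of_; const)
open import Function.Bundles using (_⇔_; mk⇔; module Equivalence)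
open import Level using (0ℓ)
open import Relation.Binary.Definitions using (tri<; tri≈; tri>)
open import Relation.Binary.PropositionalEquality
open import Relation.Nullary using (¬_; Dec; yes; no; contradiction)
open import Relation.Nullary.Decidable
  using (_×-dec_; _⊎-dec_; ¬?; from-yes; from-no)
open import Relation.Unary
  using (Pred; Decidable; _∈_; _⊆_; _≐_; _∪_; _∩_; _∖_; ｛_｝; Satisfiable)
open import Relation.Unary.Properties using (_∩?_; _∪?_; ∁?; ≐-sym; ≐-trans; ≐-refl)

-- The enumeration of the primes

p-suc : ∀ i → IsLeastPrimeFrom (suc (p i)) (p (suc i))
p-suc i = proj₂ (nextPrime (p i))

p-prime : ∀ {i} → 1 ≤ i → Prime (p i)
p-prime {suc i} _ = proj₁ (p-suc i)

p-<-suc : ∀ i → p i < p (suc i)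
p-<-suc i = proj₁ (proj₂ (p-suc i))

i≤p[i] : ∀ i → i ≤ p i
i≤p[i] zero    = z≤n
i≤p[i] (suc i) = ≤-<-trans (i≤p[i] i) (p-<-suc i)

-- The bound `i ≤ p i` gives `q ≤ p q`. Descending from this index leads to some `k` with
-- `p k < q ≤ p (suc k)`, and the minimality of `p (suc k)` among the primes above `p k` forces
-- equality.
p-surjective : ∀ {q} → Prime q → ∃ λ i → 1 ≤ i × p i ≡ q
p-surjective {q} q-prime = below q (i≤p[i] q)
  where
  below : ∀ k → q ≤ p k → ∃ λ i → 1 ≤ i × p i ≡ q
  below zero    q≤0 = contradiction (subst Prime (n≤0⇒n≡0 q≤0) q-prime) ¬prime[0]
  below (suc k) q≤p with q ≤? p k
  ... | yes q≤pₖ = below k q≤pₖ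
  ... | no  q≰pₖ =
    suc k , s≤s z≤n , ≤-antisym (proj₂ (proj₂ (p-suc k)) q-prime (≰⇒> q≰pₖ)) q≤p

p[1]≡2 : p 1 ≡ 2
p[1]≡2 with p-suc 0
... | pr , _ , least =
  ≤-antisym (least prime[2] (s≤s z≤n)) (nonTrivial⇒n>1 _ {{prime⇒nonTrivial pr}})

p[2]≡3 : p 2 ≡ 3
p[2]≡3 with p-suc 1
... | _ , p₁<p₂ , least = ≤-antisym
  (least (from-yes (prime? 3)) (≤-reflexive (cong suc p[1]≡2)))
  (subst (_< p 2) p[1]≡2 p₁<p₂)

-- The index of the least prime divisor

-- The membership condition of `S j n` freed from its bounds on `m`. As `p` is increasing, it says
-- that `p j` is the least prime divisor of `m`.
IsLeastPrimeIndex : ℕ → Pred ℕ 0ℓ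
IsLeastPrimeIndex m j = 1 ≤ j × p j ∣ m × (∀ i → 1 ≤ i → i < j → p i ∤ m)

leastPrimeIndex-unique : ∀ {m i j} → IsLeastPrimeIndex m i → IsLeastPrimeIndex m j → i ≡ j
leastPrimeIndex-unique {i = i} {j} (1≤i , pᵢ∣m , i-least) (1≤j , pⱼ∣m , j-least) with <-cmp i j
... | tri< i<j _ _ = contradiction pᵢ∣m (j-least i 1≤i i<j)
... | tri≈ _ i≡j _ = i≡j
... | tri> _ _ j<i = contradiction pⱼ∣m (i-least j 1≤j j<i)

searchIndex : ∀ m k → ∃ (IsLeastPrimeIndex m) ⊎ (∀ i → 1 ≤ i → i ≤ k → p i ∤ m)
searchIndex m zero    = inj₂ λ _ 1≤i i≤0 → contradiction (≤-trans 1≤i i≤0) λ ()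
searchIndex m (suc k) with searchIndex m k
... | inj₁ found = inj₁ found
... | inj₂ none with p (suc k) ∣? m
...   | yes p∣m = inj₁ (suc k , s≤s z≤n , p∣m , λ i 1≤i i<k → none i 1≤i (≤-pred i<k))
...   | no  p∤m = inj₂ none′
  where
  none′ : ∀ i → 1 ≤ i → i ≤ suc k → p i ∤ m
  none′ i 1≤i i≤1+k with m≤n⇒m<n∨m≡n i≤1+k
  ... | inj₁ i<1+k = none i 1≤i (≤-pred i<1+k)
  ... | inj₂ refl  = p∤m

-- Junk value 0 for m ≤ 1; the bound m on the search suffices since i ≤ p i.
idx : ℕ → ℕ
idx m = [ proj₁ , const 0 ]′ (searchIndex m m)

primeDivisor : ∀ {m} → 2 ≤ m → ∃ λ q → Prime q × q ∣ m
primeDivisor {m} 2≤m with factorise m {{>-nonZero (<-trans z<s 2≤m)}}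
... | record { factors = [] ; isFactorisation = refl } = contradiction 2≤m λ { (s≤s ()) }
... | record { factors = q ∷ _ ; isFactorisation = refl ; factorsPrime = q-prime ∷ _ } =
  q , q-prime , m∣m*n _

idx-least : ∀ {m} → 2 ≤ m → IsLeastPrimeIndex m (idx m)
idx-least {m} 2≤m with searchIndex m m
... | inj₁ (_ , least) = least
... | inj₂ none with primeDivisor 2≤m
...   | q , q-prime , q∣m with p-surjective q-prime
...     | i , 1≤i , refl =
  contradiction q∣m (none i 1≤i (≤-trans (i≤p[i] i) (∣⇒≤ {{>-nonZero (<-trans z<s 2≤m)}} q∣m)))

2∣⇒idx≡1 : ∀ {m} → 2 ≤ m → 2 ∣ m → idx m ≡ 1
2∣⇒idx≡1 {m} 2≤m 2∣m = leastPrimeIndex-unique (idx-least 2≤m)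
  (≤-refl , subst (_∣ m) (sym p[1]≡2) 2∣m , λ i 1≤i i<1 → contradiction (≤-trans i<1 1≤i) (n≮n i))

idx≡1⇒2∣ : ∀ {m} → 2 ≤ m → idx m ≡ 1 → 2 ∣ m
idx≡1⇒2∣ {m} 2≤m idx≡1 =
  subst (_∣ m) (trans (cong p idx≡1) p[1]≡2) (proj₁ (proj₂ (idx-least 2≤m)))

3∣∧2∤⇒idx≡2 : ∀ {m} → 2 ≤ m → 3 ∣ m → 2 ∤ m → idx m ≡ 2
3∣∧2∤⇒idx≡2 {m} 2≤m 3∣m 2∤m = leastPrimeIndex-unique (idx-least 2≤m)
  (s≤s z≤n , subst (_∣ m) (sym p[2]≡3) 3∣m , λ
    { 1 _ _ p₁∣m → 2∤m (subst (_∣ m) p[1]≡2 p₁∣m)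
    ; (2+ _) _ (s≤s (s≤s ())) })

idx≡2⇒3∣ : ∀ {m} → 2 ≤ m → idx m ≡ 2 → 3 ∣ m
idx≡2⇒3∣ {m} 2≤m idx≡2 =
  subst (_∣ m) (trans (cong p idx≡2) p[2]≡3) (proj₁ (proj₂ (idx-least 2≤m)))

idx≡2⇒2∤ : ∀ {m} → 2 ≤ m → idx m ≡ 2 → 2 ∤ m
idx≡2⇒2∤ 2≤m idx≡2 2∣m = contradiction (trans (sym idx≡2) (2∣⇒idx≡1 2≤m 2∣m)) λ ()

-- Families of fibres of a labelling

Fibre : ℕ → (ℕ → ℕ) → ℕ → Pred ℕ 0ℓ
Fibre n f j m = m ∈ [2⋯ n ] × f m ≡ j

-- Both partitions take this form for a suitable labelling, which turns the abstract notion of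
-- conflict into a decidable one.
Fibres : ℕ → (ℕ → ℕ) → Family
Fibres n f A = ∃ λ j → Satisfiable (Fibre n f j) × A ≐ Fibre n f j

Conflict : ℕ → (ℕ → ℕ) → ℕ → ℕ → Set
Conflict n f a b =
  a ∈ [2⋯ n ] × b ∈ [2⋯ n ] × a < b × (gcd a b ≡ 1 × f a ≡ f b ⊎ gcd a b > 1 × f a ≢ f b)

conflict? : ∀ n f a b → Dec (Conflict n f a b)
conflict? n f a b =
  (2 ≤? a ×-dec a ≤? n) ×-dec (2 ≤? b ×-dec b ≤? n) ×-dec a <? b ×-dec
  (gcd a b ≟ 1 ×-dec f a ≟ f b ⊎-dec 1 <? gcd a b ×-dec ¬? (f a ≟ f b))

module _ {n : ℕ} {f : ℕ → ℕ} {𝒫 : Family} (𝒫≐ : 𝒫 ≐ Fibres n f) where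

  fibre∈ : ∀ {a} → a ∈ [2⋯ n ] → Fibre n f (f a) ∈ 𝒫
  fibre∈ a∈X = proj₂ 𝒫≐ (_ , (_ , a∈X , refl) , ≐-refl)

  sameLabel : ∀ {A a b} → A ∈ 𝒫 → a ∈ A → b ∈ A → f a ≡ f b
  sameLabel A∈𝒫 a∈A b∈A with proj₁ 𝒫≐ A∈𝒫
  ... | _ , _ , A⊆ , _ = trans (proj₂ (A⊆ a∈A)) (sym (proj₂ (A⊆ b∈A)))

  sameClass : ∀ {A B a b} → A ∈ 𝒫 → B ∈ 𝒫 → a ∈ A → b ∈ B → f a ≡ f b → A ≐ B
  sameClass A∈𝒫 B∈𝒫 a∈A b∈B fa≡fb with proj₁ 𝒫≐ A∈𝒫 | proj₁ 𝒫≐ B∈𝒫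
  ... | i , _ , A≐ | j , _ , B≐
    with trans (sym (proj₂ (proj₁ A≐ a∈A))) (trans fa≡fb (proj₂ (proj₁ B≐ b∈B)))
  ...   | refl = ≐-trans A≐ (≐-sym B≐)

  isPartition : IsPartition [2⋯ n ] 𝒫
  isPartition = record
    { nonempty = λ A∈𝒫 → let (_ , (x , x∈F) , A≐) = proj₁ 𝒫≐ A∈𝒫 in x , proj₂ A≐ x∈F
    ; within   = λ A∈𝒫 x∈A → let (_ , _ , A≐) = proj₁ 𝒫≐ A∈𝒫 in proj₁ (proj₁ A≐ x∈A)
    ; disjoint = λ { A∈𝒫 B∈𝒫 (_ , x∈A , x∈B) → sameClass A∈𝒫 B∈𝒫 x∈A x∈B refl }
    ; cover    = λ x∈X → _ , fibre∈ x∈X , x∈X , refl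
    }

  -- Two elements share a class exactly when their labels agree: fibres over equal labels coincide,
  -- and a nonempty fibre determines its label. The order `a < b` supplies `a ≢ b`.
  conflict⇔ : ∀ a b → Conflict n f a b ⇔ (a ∈ [2⋯ n ] × b ∈ [2⋯ n ] × a < b × InConflict 𝒫 a b)
  conflict⇔ a b = mk⇔ to from
    where
    to : Conflict n f a b → a ∈ [2⋯ n ] × b ∈ [2⋯ n ] × a < b × InConflict 𝒫 a b
    to (a∈X , b∈X , a<b , inj₁ (gcd≡1 , fa≡fb)) = a∈X , b∈X , a<b ,
      inj₁ ((<⇒≢ a<b , gcd≡1) , _ , fibre∈ a∈X , (a∈X , refl) , (b∈X , sym fa≡fb))
    to (a∈X , b∈X , a<b , inj₂ (gcd>1 , fa≢fb)) = a∈X , b∈X , a<b ,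
      inj₂ ((<⇒≢ a<b , gcd>1) , _ , _ , fibre∈ a∈X , fibre∈ b∈X , (a∈X , refl) , (b∈X , refl) ,
            λ A≐B → fa≢fb (proj₂ (proj₁ A≐B (a∈X , refl))))

    from : a ∈ [2⋯ n ] × b ∈ [2⋯ n ] × a < b × InConflict 𝒫 a b → Conflict n f a b
    from (a∈X , b∈X , a<b , inj₁ ((_ , gcd≡1) , _ , A∈𝒫 , a∈A , b∈A)) =
      a∈X , b∈X , a<b , inj₁ (gcd≡1 , sameLabel A∈𝒫 a∈A b∈A)
    from (a∈X , b∈X , a<b , inj₂ ((_ , gcd>1) , _ , _ , A∈𝒫 , B∈𝒫 , a∈A , b∈B , A≭B)) =
      a∈X , b∈X , a<b , inj₂ (gcd>1 , λ fa≡fb → A≭B (sameClass A∈𝒫 B∈𝒫 a∈A b∈B fa≡fb))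

-- Counting in 1 … n

range : ℕ → List ℕ
range = applyUpTo suc

∈-range⁺ : ∀ {m n} → 1 ≤ m → m ≤ n → m ∈ₗ range n
∈-range⁺ {suc m} _ m<n = ∈-applyUpTo⁺ suc m<n

∈-range⁻ : ∀ {m n} → m ∈ₗ range n → 1 ≤ m × m ≤ n
∈-range⁻ m∈ with ∈-applyUpTo⁻ suc m∈
... | _ , m<n , refl = s≤s z≤n , m<n

range-unique : ∀ n → Unique (range n)
range-unique n = Unique.applyUpTo⁺₁ suc n λ i<j _ → <⇒≢ i<j ∘ suc-injective

count : {P : Pred ℕ 0ℓ} → Decidable P → ℕ → ℕ
count P? n = length (filter P? (range n))

module _ {P Q : Pred ℕ 0ℓ} (P? : Decidable P) (Q? : Decidable Q) where

  length-filter-split : ∀ xs → length (filter P? xs) ≡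
    length (filter (Q? ∩? P?) xs) + length (filter (∁? Q? ∩? P?) xs)
  length-filter-split [] = refl
  length-filter-split (x ∷ xs) with Q? x | P? x
  ... | yes _ | yes _ = cong suc (length-filter-split xs)
  ... | yes _ | no  _ = length-filter-split xs
  ... | no  _ | yes _ = trans (cong suc (length-filter-split xs)) (sym (+-suc _ _))
  ... | no  _ | no  _ = length-filter-split xs

  count-split : ∀ n → count P? n ≡ count (Q? ∩? P?) n + count (∁? Q? ∩? P?) n
  count-split n = length-filter-split (range n)

  count-≐ : P ≐ Q → ∀ n → count P? n ≡ count Q? n
  count-≐ P≐Q n = cong length (filter-≐ P? Q? P≐Q (range n))

module _ {P Q R : Pred ℕ 0ℓ} (P? : Decidable P) (Q? : Decidable Q) (R? : Decidable R) where

  length-filter-cover : ∀ xs → (∀ {x} → x ∈ₗ xs → P x → Q x ⊎ R x) →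
    length (filter P? xs) ≤ length (filter Q? xs) + length (filter R? xs)
  length-filter-cover []       _     = z≤n
  length-filter-cover (x ∷ xs) cover with P? x | Q? x | R? x | length-filter-cover xs (cover ∘ there)
  ... | yes _ | yes _ | yes _ | ih = s≤s (≤-trans ih (+-monoʳ-≤ _ (n≤1+n _)))
  ... | yes _ | yes _ | no  _ | ih = s≤s ih
  ... | yes _ | no  _ | yes _ | ih = ≤-trans (s≤s ih) (≤-reflexive (sym (+-suc _ _)))
  ... | yes Px | no ¬Qx | no ¬Rx | _ = contradiction (cover (here refl) Px) [ ¬Qx , ¬Rx ]′
  ... | no  _ | yes _ | yes _ | ih = m≤n⇒m≤1+n (≤-trans ih (+-monoʳ-≤ _ (n≤1+n _)))
  ... | no  _ | yes _ | no  _ | ih = m≤n⇒m≤1+n ih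
  ... | no  _ | no  _ | yes _ | ih = ≤-trans ih (+-monoʳ-≤ _ (n≤1+n _))
  ... | no  _ | no  _ | no  _ | ih = ih

  count-cover : ∀ n → (∀ {x} → 1 ≤ x → x ≤ n → P x → Q x ⊎ R x) →
    count P? n ≤ count Q? n + count R? n
  count-cover n cover = length-filter-cover (range n) λ x∈ →
    let (1≤x , x≤n) = ∈-range⁻ x∈ in cover 1≤x x≤n

module _ {Q : Pred ℕ 0ℓ} (Q? : Decidable Q) (q : ℕ) .{{_ : NonZero q}} where

  -- Multiplication by `q` maps the numbers up to `n / q` bijectively onto the multiples of `q` up
  -- to `n`. Both lists are repetition-free with the same elements, hence permutations of each
  -- other.
  count-multiples : ∀ n → count ((q ∣?_) ∩? Q?) n ≡ count (Q? ∘ (q *_)) (n / q)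
  count-multiples n = trans (↭-length (∼bag⇒↭ (unique∧set⇒bag
      (Unique.filter⁺ ((q ∣?_) ∩? Q?) (range-unique n))
      (Unique.map⁺ (*-cancelˡ-≡ _ _ q) (Unique.filter⁺ (Q? ∘ (q *_)) (range-unique (n / q))))
      (mk⇔ to from))))
    (length-map (q *_) quotients)
    where
    multiples quotients : List ℕ
    multiples = filter ((q ∣?_) ∩? Q?) (range n)
    quotients = filter (Q? ∘ (q *_)) (range (n / q))

    to : ∀ {x} → x ∈ₗ multiples → x ∈ₗ map (q *_) quotients
    to x∈ with ∈-filter⁻ ((q ∣?_) ∩? Q?) {xs = range n} x∈
    ... | x∈range , divides c refl , Qx with ∈-range⁻ x∈range
    ...   | 1≤cq , cq≤n = subst (_∈ₗ map (q *_) quotients) (*-comm q c) (∈-map⁺ (q *_)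
      (∈-filter⁺ (Q? ∘ (q *_))
        (∈-range⁺ (n≢0⇒n>0 λ { refl → contradiction 1≤cq λ () })
          (subst (_≤ n / q) (m*n/n≡m c q) (/-monoˡ-≤ q cq≤n)))
        (subst Q (*-comm c q) Qx)))

    from : ∀ {x} → x ∈ₗ map (q *_) quotients → x ∈ₗ multiples
    from x∈ with ∈-map⁻ (q *_) x∈
    ... | c , c∈ , refl with ∈-filter⁻ (Q? ∘ (q *_)) {xs = range (n / q)} c∈
    ...   | c∈range , Qqc with ∈-range⁻ c∈range
    ...     | 1≤c , c≤n/q = ∈-filter⁺ ((q ∣?_) ∩? Q?)
      (∈-range⁺ (*-mono-≤ (>-nonZero⁻¹ q) 1≤c)
        (≤-trans (*-monoʳ-≤ q c≤n/q) (subst (_≤ n) (*-comm (n / q) q) (m/n*n≤m n q))))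
      (m∣m*n c , Qqc)

-- Legendre's sieve

NoneDivides : List ℕ → Pred ℕ 0ℓ
NoneDivides qs c = All (_∤ c) qs

noneDivides? : ∀ qs → Decidable (NoneDivides qs)
noneDivides? qs c = all? (λ q → ¬? (q ∣? c)) qs

-- Legendre's sieve recursion, meaningful only for nonzero moduli.
legendre : ℕ → List ℕ → ℕ
legendre n []               = n
legendre n (zero ∷ qs)      = 0
legendre n (q@(suc _) ∷ qs) = legendre n qs ∸ legendre (n / q) qs

-- A modulus coprime to `q` divides `q * c` only if it divides `c`, so the factor `q` is invisible
-- to the sieve.
noneDivides-* : ∀ {q qs} → All (Coprime q) qs → NoneDivides qs ∘ (q *_) ≐ NoneDivides qs
noneDivides-* {q} {qs} coprimes =
  (λ none → All.map (λ r∤qc r∣c → r∤qc (∣n⇒∣m*n q r∣c)) none) ,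
  λ none → All.zipWith
    (λ { (coprime , r∤c) r∣qc → r∤c (coprime-divisor (coprime-sym coprime) r∣qc) })
    (coprimes , none)

-- The numbers that survive `q ∷ qs` are the survivors of `qs` without the multiples of `q` among
-- them. Those multiples are counted by the companion statement, whose proof returns to the shorter
-- list `qs`.
count-legendre : ∀ {qs} → All NonZero qs → AllPairs Coprime qs →
  ∀ n → count (noneDivides? qs) n ≡ legendre n qs
count-multiples-legendre : ∀ q {qs} .{{_ : NonZero q}} →
  All NonZero qs → AllPairs Coprime (q ∷ qs) →
  ∀ n → count ((q ∣?_) ∩? noneDivides? qs) n ≡ legendre (n / q) qs

count-legendre [] [] n =
  trans (cong length (filter-all (noneDivides? []) (All.universal (λ _ → []) (range n))))
    (length-applyUpTo suc n)
count-legendre {q@(suc _) ∷ qs} (_ ∷ nz) (coprime ∷ coprimes) n = begin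
  count (noneDivides? (q ∷ qs)) n
    ≡⟨ count-≐ (noneDivides? (q ∷ qs)) (∁? (q ∣?_) ∩? noneDivides? qs)
         ((λ { (q∤c ∷ none) → q∤c , none }) , λ { (q∤c , none) → q∤c ∷ none }) n ⟩
  rest
    -- The truncated subtraction is exact, because `multiples` is a summand of the whole count.
    ≡⟨ m+n∸m≡n multiples rest ⟨
  multiples + rest ∸ multiples
    ≡⟨ cong (_∸ multiples) (count-split (noneDivides? qs) (q ∣?_) n) ⟨
  count (noneDivides? qs) n ∸ multiples
    ≡⟨ cong₂ _∸_ (count-legendre nz coprimes n)
         (count-multiples-legendre q nz (coprime ∷ coprimes) n) ⟩
  legendre n qs ∸ legendre (n / q) qs ∎
  where
  open ≡-Reasoning
  multiples rest : ℕ
  multiples = count ((q ∣?_) ∩? noneDivides? qs) n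
  rest      = count (∁? (q ∣?_) ∩? noneDivides? qs) n

count-multiples-legendre q {qs} nz (coprime ∷ coprimes) n = begin
  count ((q ∣?_) ∩? noneDivides? qs) n
    ≡⟨ count-multiples (noneDivides? qs) q n ⟩
  count (noneDivides? qs ∘ (q *_)) (n / q)
    ≡⟨ count-≐ (noneDivides? qs ∘ (q *_)) (noneDivides? qs) (noneDivides-* coprime) (n / q) ⟩
  count (noneDivides? qs) (n / q)
    ≡⟨ count-legendre nz coprimes (n / q) ⟩
  legendre (n / q) qs ∎
  where open ≡-Reasoning

-- Counting conflicts

lowerConflict? : ∀ n f (ab : ℕ × ℕ) → Dec (proj₂ ab < n × Conflict n f (proj₁ ab) (proj₂ ab))
lowerConflict? n f (a , b) = b <? n ×-dec conflict? n f a b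

lowerConflicts : ℕ → (ℕ → ℕ) → List (ℕ × ℕ)
lowerConflicts n f = filter (lowerConflict? n f) (cartesianProduct (range n) (range n))

topConflict? : ∀ n f a → Dec (Conflict n f a n)
topConflict? n f a = conflict? n f a n

-- Conflicting pairs are split by their larger element: it is either below `n` or equal to `n`. The
-- first part can then be matched between the two partitions without being computed.
conflictCount : ∀ {n f 𝒫} → 𝒫 ≐ Fibres n f →
  ConflictCount [2⋯ n ] 𝒫 (length (lowerConflicts n f) + count (topConflict? n f) n)
conflictCount {n} {f} 𝒫≐ = lower ++ map (_, n) top
  , Unique.++⁺
      (Unique.filter⁺ (lowerConflict? n f)
        (Unique.cartesianProduct⁺ (range-unique n) (range-unique n)))
      (Unique.map⁺ (cong proj₁) (Unique.filter⁺ (topConflict? n f) (range-unique n)))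
      disjoint
  , trans (length-++ lower) (cong (length lower +_) (length-map (_, n) top))
  , λ a b → mk⇔ (Equivalence.to (conflict⇔ 𝒫≐ a b) ∘ to) (from ∘ Equivalence.from (conflict⇔ 𝒫≐ a b))
  where
  lower : List (ℕ × ℕ)
  lower = lowerConflicts n f

  top : List ℕ
  top = filter (topConflict? n f) (range n)

  lower⁻ : ∀ {ab} → ab ∈ₗ lower → proj₂ ab < n × Conflict n f (proj₁ ab) (proj₂ ab)
  lower⁻ ab∈ =
    proj₂ (∈-filter⁻ (lowerConflict? n f) {xs = cartesianProduct (range n) (range n)} ab∈)

  disjoint : Disjoint lower (map (_, n) top)
  disjoint (ab∈lower , ab∈top) with ∈-map⁻ (_, n) ab∈top
  ... | _ , _ , refl = n≮n n (proj₁ (lower⁻ ab∈lower))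

  to : ∀ {a b} → (a , b) ∈ₗ lower ++ map (_, n) top → Conflict n f a b
  to ab∈ with ∈-++⁻ lower ab∈
  ... | inj₁ ab∈lower = proj₂ (lower⁻ ab∈lower)
  ... | inj₂ ab∈top with ∈-map⁻ (_, n) ab∈top
  ...   | _ , a∈top , refl = proj₂ (∈-filter⁻ (topConflict? n f) {xs = range n} a∈top)

  inRange : ∀ {a} → a ∈ [2⋯ n ] → a ∈ₗ range n
  inRange (2≤a , a≤n) = ∈-range⁺ (<⇒≤ 2≤a) a≤n

  from : ∀ {a b} → Conflict n f a b → (a , b) ∈ₗ lower ++ map (_, n) top
  from c@(a∈X , b∈X@(_ , b≤n) , _) with m≤n⇒m<n∨m≡n b≤n
  ... | inj₁ b<n  = ∈-++⁺ˡ (∈-filter⁺ (lowerConflict? n f)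
    (∈-cartesianProduct⁺ (inRange a∈X) (inRange b∈X)) (b<n , c))
  ... | inj₂ refl = ∈-++⁺ʳ lower (∈-map⁺ (_, n) (∈-filter⁺ (topConflict? n f) (inRange a∈X) c))

conflict-cong : ∀ {n} f g {a b} → f a ≡ g a → f b ≡ g b → Conflict n f a b → Conflict n g a b
conflict-cong _ _ fa≡ga fb≡gb (a∈X , b∈X , a<b , inj₁ (gcd≡1 , fa≡fb)) =
  a∈X , b∈X , a<b , inj₁ (gcd≡1 , trans (sym fa≡ga) (trans fa≡fb fb≡gb))
conflict-cong _ _ fa≡ga fb≡gb (a∈X , b∈X , a<b , inj₂ (gcd>1 , fa≢fb)) =
  a∈X , b∈X , a<b , inj₂ (gcd>1 , λ ga≡gb → fa≢fb (trans fa≡ga (trans ga≡gb (sym fb≡gb))))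

-- A pair `a < b < n` never consults the label of `n`, the only one on which the two labellings may
-- differ.
lowerConflicts-cong : ∀ {n f g} → (∀ {m} → m < n → f m ≡ g m) →
  lowerConflicts n f ≡ lowerConflicts n g
lowerConflicts-cong {n} {f} {g} f≗g = filter-≐ (lowerConflict? n f) (lowerConflict? n g)
  ( (λ { (b<n , c@(_ , _ , a<b , _)) → b<n , conflict-cong f g (f≗g (<-trans a<b b<n)) (f≗g b<n) c })
  , (λ { (b<n , c@(_ , _ , a<b , _)) →
         b<n , conflict-cong g f (sym (f≗g (<-trans a<b b<n))) (sym (f≗g b<n)) c }))
  (cartesianProduct (range n) (range n))

-- The two partitions as families of fibres

-- A member of `S j n` is positive and divisible by a prime, hence at least 2. This reconciles the
-- lower bound 1 in `S` with the lower bound 2 in `Fibre`.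
S≐Fibre : ∀ {n j} → 1 ≤ j → S j n ≐ Fibre n idx j
S≐Fibre {n} {j} 1≤j = to , from
  where
  to : S j n ⊆ Fibre n idx j
  to (1≤m , m≤n , p∣m , least) = (2≤m , m≤n) ,
    leastPrimeIndex-unique (idx-least 2≤m) (1≤j , p∣m , least)
    where
    2≤m = ≤-trans (nonTrivial⇒n>1 _ {{prime⇒nonTrivial (p-prime 1≤j)}}) (∣⇒≤ {{>-nonZero 1≤m}} p∣m)

  from : Fibre n idx j ⊆ S j n
  from ((2≤m , m≤n) , refl) = <⇒≤ 2≤m , m≤n , proj₂ (idx-least 2≤m)

standardPartition≐ : ∀ n → standardPartition n ≐ Fibres n idx
standardPartition≐ n =
  (λ { (j , 1≤j , (x , x∈S) , A≐S) →
       j , (x , proj₁ (S≐Fibre 1≤j) x∈S) , ≐-trans A≐S (S≐Fibre 1≤j) }) ,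
  (λ { (_ , (x , x∈F@((2≤x , _) , refl)) , A≐F) →
       let S≐F = S≐Fibre (proj₁ (idx-least 2≤x)) in
       idx x , proj₁ (idx-least 2≤x) , (x , proj₂ S≐F x∈F) , ≐-trans A≐F (≐-sym S≐F) })

-- Meant for an `n` of index 2, which thereby joins the even numbers, whose label is 1.
relabel : ℕ → ℕ → ℕ
relabel n m with m ≟ n
... | yes _ = 1
... | no  _ = idx m

relabel-≡ : ∀ n → relabel n n ≡ 1
relabel-≡ n with n ≟ n
... | yes _   = refl
... | no  n≢n = contradiction refl n≢n

relabel-≢ : ∀ {n m} → m ≢ n → relabel n m ≡ idx m
relabel-≢ {n} {m} m≢n with m ≟ n
... | yes m≡n = contradiction m≡n m≢n
... | no  _   = refl

module _ {n : ℕ} (3<n : 3 < n) (2∤n : 2 ∤ n) (3∣n : 3 ∣ n) where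

  private
    2≤n : 2 ≤ n
    2≤n = ≤-trans (s≤s (s≤s z≤n)) 3<n

    idx[n]≡2 : idx n ≡ 2
    idx[n]≡2 = 3∣∧2∤⇒idx≡2 2≤n 3∣n 2∤n

    -- The least prime divisor of `n` is 3, so `n` lies in the second class only.
    S⇒≢n : ∀ {j m} → 1 ≤ j → j ≢ 2 → m ∈ S j n → m ≢ n
    S⇒≢n 1≤j j≢2 m∈S refl = j≢2 (trans (sym (proj₂ (proj₁ (S≐Fibre 1≤j) m∈S))) idx[n]≡2)

    S⊆Fibre : ∀ {j m} → 1 ≤ j → m ≢ n → m ∈ S j n → m ∈ Fibre n (relabel n) j
    S⊆Fibre 1≤j m≢n m∈S with proj₁ (S≐Fibre 1≤j) m∈S
    ... | m∈X , idx≡j = m∈X , trans (relabel-≢ m≢n) idx≡j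

    Fibre⊆S : ∀ {j m} → 1 ≤ j → m ≢ n → m ∈ Fibre n (relabel n) j → m ∈ S j n
    Fibre⊆S 1≤j m≢n (m∈X , label≡j) =
      proj₂ (S≐Fibre 1≤j) (m∈X , trans (sym (relabel-≢ m≢n)) label≡j)

    n∈Fibre : n ∈ Fibre n (relabel n) 1
    n∈Fibre = (2≤n , ≤-refl) , relabel-≡ n

    Fibre⇒≢n : ∀ {j m} → j ≢ 1 → m ∈ Fibre n (relabel n) j → m ≢ n
    Fibre⇒≢n j≢1 (_ , label≡j) refl = j≢1 (trans (sym label≡j) (relabel-≡ n))

    class₁ : S 1 n ∪ ｛ n ｝ ≐ Fibre n (relabel n) 1
    class₁ = to , from
      where
      to : S 1 n ∪ ｛ n ｝ ⊆ Fibre n (relabel n) 1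
      to (inj₁ m∈S)  = S⊆Fibre ≤-refl (S⇒≢n ≤-refl (λ ()) m∈S) m∈S
      to (inj₂ refl) = n∈Fibre

      from : Fibre n (relabel n) 1 ⊆ S 1 n ∪ ｛ n ｝
      from {m} m∈F = case m ≟ n of λ
        { (yes m≡n) → inj₂ (sym m≡n)
        ; (no  m≢n) → inj₁ (Fibre⊆S ≤-refl m≢n m∈F) }

    class₂ : S 2 n ∖ ｛ n ｝ ≐ Fibre n (relabel n) 2
    class₂ =
      (λ { (m∈S , n≢m) → S⊆Fibre (s≤s z≤n) (n≢m ∘ sym) m∈S }) ,
      (λ m∈F → let m≢n = Fibre⇒≢n (λ ()) m∈F in Fibre⊆S (s≤s z≤n) m≢n m∈F , m≢n ∘ sym)

    class≥₃ : ∀ {j} → 3 ≤ j → S j n ≐ Fibre n (relabel n) j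
    class≥₃ {j} 3≤j =
      (λ m∈S → S⊆Fibre 1≤j (S⇒≢n 1≤j (>⇒≢ 3≤j) m∈S) m∈S) ,
      (λ m∈F → Fibre⊆S 1≤j (Fibre⇒≢n (>⇒≢ (<⇒≤ 3≤j)) m∈F) m∈F)
      where 1≤j = ≤-trans (s≤s z≤n) 3≤j

  modifiedPartition≐ : modifiedPartition n ≐ Fibres n (relabel n)
  modifiedPartition≐ = to , from
    where
    to : modifiedPartition n ⊆ Fibres n (relabel n)
    to (inj₁ A≐) = 1 , (n , n∈Fibre) , ≐-trans A≐ class₁
    -- The witness 3 differs from `n` because `3 < n`, so the second class stays nonempty after
    -- losing `n`.
    to (inj₂ (inj₁ A≐)) = 2 , (3 , (s≤s (s≤s z≤n) , <⇒≤ 3<n) ,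
      trans (relabel-≢ (<⇒≢ 3<n)) (3∣∧2∤⇒idx≡2 (s≤s (s≤s z≤n)) ∣-refl (from-no (2 ∣? 3)))) ,
      ≐-trans A≐ class₂
    to (inj₂ (inj₂ (j , 3≤j , (x , x∈S) , A≐))) =
      j , (x , proj₁ (class≥₃ 3≤j) x∈S) , ≐-trans A≐ (class≥₃ 3≤j)

    from : Fibres n (relabel n) ⊆ modifiedPartition n
    -- The fibre over 0 is empty: `n` carries label 1, and every other element has an index of at
    -- least 1.
    from (0 , (x , x∈F@((2≤x , _) , label≡0)) , _) = contradiction
      (subst (1 ≤_) (trans (sym (relabel-≢ (Fibre⇒≢n (λ ()) x∈F))) label≡0) (proj₁ (idx-least 2≤x)))
      λ ()
    from (1 , _ , A≐) = inj₁ (≐-trans A≐ (≐-sym class₁))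
    from (2 , _ , A≐) = inj₂ (inj₁ (≐-trans A≐ (≐-sym class₂)))
    from (j@(suc (suc (suc _))) , (x , x∈F) , A≐) =
      inj₂ (inj₂ (j , 3≤j , (x , proj₂ (class≥₃ 3≤j) x∈F) , ≐-trans A≐ (≐-sym (class≥₃ 3≤j))))
      where 3≤j = s≤s (s≤s (s≤s z≤n))

  -- Comparing the conflicts that involve n

  module _ {qs : List ℕ} (qs∣n : All (λ q → 1 < q × q ∣ n) qs) (coprimes : AllPairs Coprime (2 ∷ qs))
    (sieve : legendre (n / 2) qs + legendre (n / 2) qs + legendre (n / 3) (2 ∷ []) < n / 2)
    where

    private
      standard? : Decidable (λ a → Conflict n idx a n)
      standard? = topConflict? n idx

      modified? : Decidable (λ a → Conflict n (relabel n) a n)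
      modified? = topConflict? n (relabel n)

      -- Every even enemy of `n` satisfies this, and nothing else does once `qs` lists all prime
      -- divisors of `n`.
      evenEnemy? : Decidable ((2 ∣_) ∩ NoneDivides qs)
      evenEnemy? = (2 ∣?_) ∩? noneDivides? qs

      -- The number `n` itself is included, which overcounts its possible partners by one.
      oddTriple? : Decidable ((3 ∣_) ∩ NoneDivides (2 ∷ []))
      oddTriple? = (3 ∣?_) ∩? noneDivides? (2 ∷ [])

      enemy⇒noneDivides : ∀ {a} → gcd a n ≡ 1 → NoneDivides qs a
      enemy⇒noneDivides gcd≡1 = All.map
        (λ { {q} (1<q , q∣n) q∣a →
          <⇒≢ 1<q (sym (∣1⇒≡1 (subst (q ∣_) gcd≡1 (gcd-greatest q∣a q∣n)))) }) qs∣n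

      -- After the move, a partner in conflict with `n` is either an enemy with label 1, hence even,
      -- or a friend with another label, hence odd. A friend of index 2 is an odd multiple of 3; one
      -- of any other index was in conflict before, when `n` had label 2.
      modified⇒ : ∀ {a} → Conflict n (relabel n) a n →
        (2 ∤ a × Conflict n idx a n) ⊎
        ((2 ∣ a × NoneDivides qs a) ⊎ (3 ∣ a × NoneDivides (2 ∷ []) a))
      modified⇒ ((2≤a , _) , _ , a<n , inj₁ (gcd≡1 , same)) = inj₂ (inj₁
        ( idx≡1⇒2∣ 2≤a (trans (sym (relabel-≢ (<⇒≢ a<n))) (trans same (relabel-≡ n)))
        , enemy⇒noneDivides gcd≡1))
      modified⇒ {a} (a∈X@(2≤a , _) , n∈X , a<n , inj₂ (gcd>1 , different)) with idx a ≟ 2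
      ... | yes idx≡2 = inj₂ (inj₂ (idx≡2⇒3∣ 2≤a idx≡2 , idx≡2⇒2∤ 2≤a idx≡2 ∷ []))
      ... | no  idx≢2 = inj₁
        ( (λ 2∣a → different (trans (relabel-≢ (<⇒≢ a<n))
                      (trans (2∣⇒idx≡1 2≤a 2∣a) (sym (relabel-≡ n)))))
        , a∈X , n∈X , a<n , inj₂ (gcd>1 , λ idx≡ → idx≢2 (trans idx≡ idx[n]≡2)))

      -- Before the move, an even friend of `n` has label 1 while `n` has label 2, so the two are in
      -- conflict. Parity keeps `a` distinct from `n`.
      even⇒ : ∀ {a} → 1 ≤ a → a ≤ n → 2 ∣ a × NoneDivides [] a →
        (2 ∣ a × Conflict n idx a n) ⊎ (2 ∣ a × NoneDivides qs a)
      even⇒ {a} 1≤a a≤n (2∣a , _) with gcd a n ≟ 1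
      ... | yes gcd≡1 = inj₂ (2∣a , enemy⇒noneDivides gcd≡1)
      ... | no  gcd≢1 = inj₁
        ( 2∣a , (2≤a , a≤n) , (2≤n , ≤-refl) , ≤∧≢⇒< a≤n (λ { refl → 2∤n 2∣a })
        , inj₂ ( ≤∧≢⇒< (n≢0⇒n>0 (gcd[m,n]≢0 a n (inj₁ (m<n⇒n≢0 1≤a)))) (gcd≢1 ∘ sym)
               , λ idx≡ → contradiction (trans (sym (2∣⇒idx≡1 2≤a 2∣a)) (trans idx≡ idx[n]≡2)) λ ()))
        where 2≤a = ∣⇒≤ {{>-nonZero 1≤a}} 2∣a

      nonZero-qs : All NonZero qs
      nonZero-qs = All.map (λ { (1<q , _) → >-nonZero (<⇒≤ 1<q) }) qs∣n

    -- Adding `n / 2` to both sides avoids subtraction. Let o and v count the old conflicts with odd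
    -- and even partners, and let e and t be the two sieve counts. Then the new count is at most o +
    -- e + t, while `n / 2` is at most v + e. The sum is at most (v + o) + (2e + t), where v + o is
    -- the old count and 2e + t is below `n / 2`.
    topConflicts-< : count modified? n < count standard? n
    topConflicts-< = +-cancelʳ-< (n / 2) _ _ (begin-strict
      count modified? n + n / 2
        ≤⟨ +-mono-≤
             (≤-trans
               (count-cover modified? (∁? (2 ∣?_) ∩? standard?) (evenEnemy? ∪? oddTriple?)
                 n (λ _ _ → modified⇒))
               (+-monoʳ-≤ oddConflicts
                 (count-cover (evenEnemy? ∪? oddTriple?) evenEnemy? oddTriple? n (λ _ _ x∈ → x∈))))
             (≤-trans
               -- The sieve with no moduli identifies `n / 2` as the number of even elements of 1
               -- ... n.
               (≤-reflexive (sym (count-multiples-legendre 2 [] ([] ∷ []) n)))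
               (count-cover ((2 ∣?_) ∩? noneDivides? []) ((2 ∣?_) ∩? standard?) evenEnemy? n even⇒)) ⟩
      oddConflicts + (count evenEnemy? n + count oddTriple? n) + (evenConflicts + count evenEnemy? n)
        ≡⟨ solve 4 (λ c e t f → c :+ (e :+ t) :+ (f :+ e) := f :+ c :+ (e :+ e :+ t)) refl
             oddConflicts (count evenEnemy? n) (count oddTriple? n) evenConflicts ⟩
      evenConflicts + oddConflicts + (count evenEnemy? n + count evenEnemy? n + count oddTriple? n)
        ≡⟨ cong₂ _+_ (sym (count-split standard? (2 ∣?_) n))
             (cong₂ (λ e t → e + e + t)
               (count-multiples-legendre 2 nonZero-qs coprimes n)
               (count-multiples-legendre 3 (_ ∷ []) ((from-yes (coprime? 3 2) ∷ []) ∷ [] ∷ []) n)) ⟩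
      count standard? n + (legendre (n / 2) qs + legendre (n / 2) qs + legendre (n / 3) (2 ∷ []))
        <⟨ +-monoʳ-< (count standard? n) sieve ⟩
      count standard? n + n / 2 ∎)
      where
      open ≤-Reasoning
      open +-*-Solver using (solve; _:=_; _:+_)
      oddConflicts evenConflicts : ℕ
      oddConflicts  = count (∁? (2 ∣?_) ∩? standard?) n
      evenConflicts = count ((2 ∣?_) ∩? standard?) n

    modified-improves : ∃₂ λ k l → ConflictCount [2⋯ n ] (modifiedPartition n) k
                                 × ConflictCount [2⋯ n ] (standardPartition n) l
                                 × k < l
    modified-improves =
      _ , _ , conflictCount modifiedPartition≐ , conflictCount (standardPartition≐ n) ,
      subst (λ ab → length ab + count modified? n < length (lowerConflicts n idx) + count standard? n)
        (lowerConflicts-cong {f = idx} {g = relabel n} (sym ∘ relabel-≢ ∘ <⇒≢))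
        (+-monoʳ-< (length (lowerConflicts n idx)) topConflicts-<)

-- The numerical case n₀

oddPrimes≤23 : List ℕ
oddPrimes≤23 = 3 ∷ 5 ∷ 7 ∷ 11 ∷ 13 ∷ 17 ∷ 19 ∷ 23 ∷ []

mainTheorem2 : IsPartition [2⋯ n₀ ] (modifiedPartition n₀)
    × IsPartition [2⋯ n₀ ] (standardPartition n₀)
    × (∃₂ λ k l → ConflictCount [2⋯ n₀ ] (modifiedPartition n₀) k
    × ConflictCount [2⋯ n₀ ] (standardPartition n₀) l
    × k < l)
    × ¬ HasMinimalConflicts [2⋯ n₀ ] (standardPartition n₀)
mainTheorem2 = modified , isPartition (standardPartition≐ n₀) , improves , notMinimal improves
  where
  3<n₀ : 3 < n₀
  3<n₀ = from-yes (3 <? n₀)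

  2∤n₀ : 2 ∤ n₀
  2∤n₀ = from-no (2 ∣? n₀)

  3∣n₀ : 3 ∣ n₀
  3∣n₀ = from-yes (3 ∣? n₀)

  modified : IsPartition [2⋯ n₀ ] (modifiedPartition n₀)
  modified = isPartition (modifiedPartition≐ 3<n₀ 2∤n₀ 3∣n₀)

  improves : ∃₂ λ k l → ConflictCount [2⋯ n₀ ] (modifiedPartition n₀) k
                      × ConflictCount [2⋯ n₀ ] (standardPartition n₀) l
                      × k < l
  improves = modified-improves 3<n₀ 2∤n₀ 3∣n₀
    (from-yes (all? (λ q → 1 <? q ×-dec q ∣? n₀) oddPrimes≤23))
    (from-yes (allPairs? coprime? (2 ∷ oddPrimes≤23)))
    -- Evaluating the sieve reduces the premise to 2 · 18247680 + 18591073 = 55086433 < 55773217,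
    -- which holds by computation.
    (<ᵇ⇒< _ _ _)

  notMinimal : (∃₂ λ k l → ConflictCount [2⋯ n₀ ] (modifiedPartition n₀) k
                         × ConflictCount [2⋯ n₀ ] (standardPartition n₀) l
                         × k < l) →
               ¬ HasMinimalConflicts [2⋯ n₀ ] (standardPartition n₀)
  notMinimal (_ , _ , k-count , l-count , k<l) minimal =
    -- Minimality tested against the modified partition would give `l ≤ k`.
    <⇒≱ k<l (minimal _ modified l-count k-count)
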